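{- Let $\widetilde{s}_n$ be the number of unlabeled split graphs on $n$ vertices and let $\widetilde{u}_n$ be the number of unlabeled unbalanced split graphs on $n$ vertices. Then almost all unlabeled split graphs are balanced: $$\lim_{n\to\infty}\frac{\widetilde{u}_n}{\widetilde{s}_n}=0.$$
   Context: Graphs are finite and simple. A split graph is a graph whose vertices can be partitioned into two (possibly empty) sets $K$ and $S$ such that $K$ is a clique and $S$ is a stable (independent) set; such an ordered partition $(K,S)$ is called a $KS$-partition. A split graph is balanced if it has a unique $KS$-partition, and unbalanced otherwise. Unlabeled graphs on $n$ vertices are isomorphism classes of graphs on $n$ vertices. -}

module Defs where

open import Data.Bool.Base using (Bool; true; false; T; _∧_; not)
open import Data.Bool.Properties as Bool using (∧-comm; ∧-idem; ∧-identityʳ; ∧-zeroʳ; T?)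
open import Data.Fin.Base using (Fin; zero; suc; finToFun; funToFin)
open import Data.Fin.Permutation using (Permutation′; _⟨$⟩ʳ_; _⟨$⟩ˡ_; permutation; inverseʳ; inverseˡ)
import Data.Fin.Permutation as Perm
open import Data.Fin.Properties using (_≟_; any?; all?; 2↔Bool; finToFun-funToFin)
open import Data.Fin.Subset using (Subset; _∈_; _∪_; _∩_; ⊤; ⊥)
open import Data.Fin.Subset.Properties using (_∈?_; anySubset?; ∪-identityˡ; ∩-zeroˡ; ∉⊥)
open import Data.List.Base using (List; lookup; length; deduplicate; mapMaybe; allFin; _∷_)
open import Data.List.Membership.Propositional.Properties using (∈-allFin; ∈-lookup)
import Data.List.Relation.Unary.All as All
open import Data.List.Relation.Unary.AllPairs using (_∷_)
open import Data.List.Relation.Unary.Any as Any using (index)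
import Data.List.Relation.Unary.Any.Properties as Any
open import Data.List.Relation.Unary.Enumerates.Setoid using (IsEnumeration)
open import Data.List.Relation.Unary.Enumerates.Setoid.Properties using (deduplicate⁺)
import Data.List.Relation.Unary.Unique.Setoid as Unique
open import Data.List.Relation.Unary.Unique.DecSetoid.Properties using (deduplicate-!)
open import Data.Maybe.Base using (Maybe; just; nothing)
import Data.Maybe.Relation.Unary.Any as Maybe
open import Data.Nat.Base using (ℕ; _≥_; _^_; NonZero)
open import Data.Product using (Σ; ∃; ∃!; _×_; _,_; proj₁; proj₂)
import Data.Product.Properties as Product
open import Data.Rational.Base using (ℚ; 0ℚ; _<_; _-_; ∣_∣)
import Data.Vec.Properties as Vec
open import Function.Base using (_∘_; _on_)
open import Function.Bundles using (Inverse)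
open import Level using (0ℓ)
open import Relation.Binary.Bundles using (Setoid; DecSetoid)
open import Relation.Binary.Definitions using (DecidableEquality)
open import Relation.Binary.PropositionalEquality
  using (_≡_; _≢_; refl; sym; trans; cong; cong₂; subst; setoid)
open import Relation.Nullary.Decidable
  using (Dec; yes; no; does; map′; ¬?; _×-dec_; _→-dec_; decidable-stable; dec-true; dec-false)
open import Relation.Nullary.Negation using (¬_; contradiction)

private
  variable
    n : ℕ

------------------------------------------------------------------------
-- Graphs and isomorphism

record Graph (n : ℕ) : Set where
  field
    adj        : Fin n → Fin n → Bool
    adj-sym    : ∀ i j → adj i j ≡ adj j i
    adj-irrefl : ∀ i → adj i i ≡ false

  Adj : Fin n → Fin n → Set
  Adj i j = T (adj i j)

open Graph public

infix 4 _≅_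

_≅_ : Graph n → Graph n → Set
_≅_ {n} G H =
  Σ (Permutation′ n) λ π → ∀ i j → adj G i j ≡ adj H (π ⟨$⟩ʳ i) (π ⟨$⟩ʳ j)

------------------------------------------------------------------------
-- Split graphs

Clique : Graph n → Subset n → Set
Clique G K = ∀ i j → i ∈ K → j ∈ K → i ≢ j → Adj G i j

Stable : Graph n → Subset n → Set
Stable G S = ∀ i j → i ∈ S → j ∈ S → ¬ Adj G i j

IsKSPartition : Graph n → Subset n × Subset n → Set
IsKSPartition G (K , S) = (K ∪ S ≡ ⊤) × (K ∩ S ≡ ⊥) × Clique G K × Stable G S

Split : Graph n → Set
Split G = ∃ (IsKSPartition G)

Balanced : Graph n → Set
Balanced G = ∃! _≡_ (IsKSPartition G)

Unbalanced : Graph n → Set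
Unbalanced G = Split G × ¬ Balanced G

------------------------------------------------------------------------
-- Unlabeled graphs

≅-refl : {G : Graph n} → G ≅ G
≅-refl = Perm.id , λ _ _ → refl

≅-sym : {G H : Graph n} → G ≅ H → H ≅ G
≅-sym {H = H} (π , eq) = Perm.flip π , λ i j →
  trans (sym (cong₂ (adj H) (inverseʳ π) (inverseʳ π)))
        (sym (eq (π ⟨$⟩ˡ i) (π ⟨$⟩ˡ j)))

≅-trans : {G H I : Graph n} → G ≅ H → H ≅ I → G ≅ I
≅-trans (π , eq) (ρ , eq′) = π Perm.∘ₚ ρ , λ i j → trans (eq i j) (eq′ _ _)

-- Agda has no quotient types: the isomorphism classes of graphs satisfying P
-- are represented by the setoid of such graphs with isomorphism as equality.
Unlabeled : (n : ℕ) → (Graph n → Set) → Setoid 0ℓ 0ℓ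
Unlabeled n P = record
  { Carrier       = Σ (Graph n) P
  ; _≈_           = _≅_ on proj₁
  ; isEquivalence = record
    { refl  = λ { {G , _} → ≅-refl {G = G} }
    ; sym   = λ { {G , _} {H , _} → ≅-sym {G = G} {H} }
    ; trans = λ { {G , _} {H , _} {I , _} → ≅-trans {G = G} {H} {I} }
    }
  }

-- A setoid bijection onto Fin k says that there are k equivalence classes.
HasSize : Setoid 0ℓ 0ℓ → ℕ → Set
HasSize S k = Inverse S (setoid (Fin k))

------------------------------------------------------------------------
-- Unlabeled n P has a size whenever P is decidable and depends only on adj

private
  lookup-injective : (S : Setoid 0ℓ 0ℓ) → let open Setoid S in
    ∀ {xs} → Unique.Unique S xs → ∀ i j → lookup xs i ≈ lookup xs j → i ≡ j
  lookup-injective S (_ ∷ _)    zero    zero    _  = refl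
  lookup-injective S (x≉ ∷ _)   zero    (suc j) eq =
    contradiction eq (All.lookup x≉ (∈-lookup j))
  lookup-injective S (x≉ ∷ _)   (suc i) zero    eq =
    contradiction (Setoid.sym S eq) (All.lookup x≉ (∈-lookup i))
  lookup-injective S (_ ∷ uniq) (suc i) (suc j) eq =
    cong suc (lookup-injective S uniq i j eq)

  enumeration⇒size : (S : DecSetoid 0ℓ 0ℓ) → ∀ {xs} →
    IsEnumeration (DecSetoid.setoid S) xs → ∃ (HasSize (DecSetoid.setoid S))
  enumeration⇒size S {xs} enum = length ys , record
    { to        = to
    ; from      = lookup ys
    ; to-cong   = to-cong
    ; from-cong = λ { refl → S.refl }
    ; inverse   =
        (λ {i} {x} x≈ → injective _ _ (S.trans (S.sym (from-to x)) x≈))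
      , (λ { {x} refl → S.sym (from-to x) })
    }
    where
    module S = DecSetoid S
    ys   = deduplicate S._≟_ xs
    ∈ys  = deduplicate⁺ S enum
    injective = lookup-injective S.setoid (deduplicate-! S xs)

    to : S.Carrier → Fin (length ys)
    to x = index (∈ys x)

    from-to : ∀ x → x S.≈ lookup ys (to x)
    from-to x = Any.lookup-index (∈ys x)

    to-cong : ∀ {x y} → x S.≈ y → to x ≡ to y
    to-cong {x} {y} x≈y =
      injective _ _ (S.trans (S.sym (from-to x)) (S.trans x≈y (from-to y)))

  anyFun? : ∀ {m n} {P : (Fin m → Fin n) → Set} →
            (∀ {f g} → (∀ i → f i ≡ g i) → P f → P g) →
            (∀ f → Dec (P f)) → Dec (∃ P)
  anyFun? {n = n} resp P? = map′
    (λ (c , p) → finToFun c , p)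
    (λ (f , p) → funToFin f , resp (λ i → sym (finToFun-funToFin f i)) p)
    (any? (λ c → P? (finToFun {n} c)))

  IsIso : Graph n → Graph n → (f g : Fin n → Fin n) → Set
  IsIso G H f g = (∀ i → f (g i) ≡ i) × (∀ i → g (f i) ≡ i)
                × (∀ i j → adj G i j ≡ adj H (f i) (f j))

  _≅?_ : (G H : Graph n) → Dec (G ≅ H)
  G ≅? H = map′
    (λ (f , g , fg , gf , eq) → permutation f g fg gf , eq)
    (λ (π , eq) → (π ⟨$⟩ʳ_) , (π ⟨$⟩ˡ_) ,
                  (λ _ → inverseʳ π) , (λ _ → inverseˡ π) , eq)
    (anyFun?
      (λ { {f} {f′} f≗ (g , fg , gf , eq) → g
         , (λ i → trans (sym (f≗ (g i))) (fg i))
         , (λ i → trans (cong g (sym (f≗ i))) (gf i))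
         , (λ i j → trans (eq i j) (cong₂ (adj H) (f≗ i) (f≗ j))) })
      (λ f → anyFun?
        (λ { {g} {g′} g≗ (fg , gf , eq) →
             (λ i → trans (cong f (sym (g≗ i))) (fg i))
           , (λ i → trans (sym (g≗ (f i))) (gf i))
           , eq })
        (λ g → all? (λ i → f (g i) ≟ i)
         ×-dec all? (λ i → g (f i) ≟ i)
         ×-dec all? (λ i → all? (λ j → adj G i j Bool.≟ adj H (f i) (f j))))))

  unlabeledDec : (n : ℕ) → (Graph n → Set) → DecSetoid 0ℓ 0ℓ
  unlabeledDec n P = record
    { Carrier          = Setoid.Carrier (Unlabeled n P)
    ; isDecEquivalence = record
      { isEquivalence = Setoid.isEquivalence (Unlabeled n P)
      ; _≟_           = λ G H → proj₁ G ≅? proj₁ H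
      }
    }

  fromMatrix : (Fin n → Fin n → Bool) → Graph n
  fromMatrix M = record
    { adj        = λ i j → (M i j ∧ M j i) ∧ not (does (i ≟ j))
    ; adj-sym    = λ i j → cong₂ _∧_ (∧-comm (M i j) (M j i)) (cong not (≟-sym i j))
    ; adj-irrefl = λ i → trans (cong (λ b → (M i i ∧ M i i) ∧ not b) (dec-true (i ≟ i) refl))
                               (∧-zeroʳ (M i i ∧ M i i))
    }
    where
    ≟-sym : ∀ i j → does (i ≟ j) ≡ does (j ≟ i)
    ≟-sym i j with i ≟ j
    ... | yes eq = sym (dec-true (j ≟ i) (sym eq))
    ... | no neq = sym (dec-false (j ≟ i) (neq ∘ sym))

  module Code {n : ℕ} where
    Code : ℕ
    Code = (2 ^ n) ^ n

    decode : Fin Code → Graph n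
    decode c = fromMatrix λ i j →
      Inverse.to 2↔Bool (finToFun {2} {n} (finToFun {2 ^ n} {n} c i) j)

    encode : Graph n → Fin Code
    encode G = funToFin λ i → funToFin λ j → Inverse.from 2↔Bool (adj G i j)

    fromMatrix-adj : (G : Graph n) {M : Fin n → Fin n → Bool} →
      (∀ i j → M i j ≡ adj G i j) → ∀ i j → adj (fromMatrix M) i j ≡ adj G i j
    fromMatrix-adj G {M} eq i j with i ≟ j
    ... | yes refl = trans (∧-zeroʳ _) (sym (adj-irrefl G i))
    ... | no _ = trans (∧-identityʳ _)
      (trans (cong₂ _∧_ (eq i j) (trans (eq j i) (adj-sym G j i))) (∧-idem _))

    decode-encode : ∀ G i j → adj (decode (encode G)) i j ≡ adj G i j
    decode-encode G = fromMatrix-adj G λ i j → trans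
      (cong (Inverse.to 2↔Bool) (trans
        (cong (λ r → finToFun {2} {n} r j) (finToFun-funToFin _ i))
        (finToFun-funToFin _ j)))
      (Inverse.strictlyInverseˡ 2↔Bool (adj G i j))

RespectsAdj : (Graph n → Set) → Set
RespectsAdj P = ∀ G H → (∀ i j → adj G i j ≡ adj H i j) → P G → P H

unlabeled-size : {P : Graph n → Set} → RespectsAdj P → (∀ G → Dec (P G)) → ∃ (HasSize (Unlabeled n P))
unlabeled-size {n} {P} resp P? = enumeration⇒size (unlabeledDec n P)
  {mapMaybe candidate (allFin Code)}
  (λ (G , p) → Any.mapMaybe⁺ candidate (allFin Code)
    (Any.map⁺ (Any.map (λ { refl → covers G p }) (∈-allFin (encode G)))))
  where
  open Code {n}

  candidate : Fin Code → Maybe (Σ (Graph n) P)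
  candidate c with P? (decode c)
  ... | yes p = just (decode c , p)
  ... | no  _ = nothing

  covers : ∀ G → P G → Maybe.Any (λ X → G ≅ proj₁ X) (candidate (encode G))
  covers G p with P? (decode (encode G))
  ... | yes _ = Maybe.just (Perm.id , λ i j → sym (decode-encode G i j))
  ... | no ¬p = contradiction (resp _ _ (λ i j → sym (decode-encode G i j)) p) ¬p

------------------------------------------------------------------------
-- Split and Unbalanced are decidable and depend only on adj

_≟ₛ_ : DecidableEquality (Subset n)
_≟ₛ_ = Vec.≡-dec Bool._≟_

isKSPartition? : (G : Graph n) → ∀ X → Dec (IsKSPartition G X)
isKSPartition? G (K , S) =
  ((K ∪ S) ≟ₛ ⊤) ×-dec ((K ∩ S) ≟ₛ ⊥)
  ×-dec all? (λ i → all? λ j →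
          (i ∈? K) →-dec (j ∈? K) →-dec ¬? (i ≟ j) →-dec T? (adj G i j))
  ×-dec all? (λ i → all? λ j →
          (i ∈? S) →-dec (j ∈? S) →-dec ¬? (T? (adj G i j)))

anyPair? : {P : Subset n × Subset n → Set} → (∀ X → Dec (P X)) → Dec (∃ P)
anyPair? P? = map′
  (λ (K , S , p) → (K , S) , p)
  (λ ((K , S) , p) → K , S , p)
  (anySubset? λ K → anySubset? λ S → P? (K , S))

_≟ₚ_ : DecidableEquality (Subset n × Subset n)
_≟ₚ_ = Product.≡-dec _≟ₛ_ _≟ₛ_

split? : (G : Graph n) → Dec (Split G)
split? G = anyPair? (isKSPartition? G)

balanced? : (G : Graph n) → Dec (Balanced G)
balanced? G = anyPair? λ X → isKSPartition? G X ×-dec map′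
  (λ none {Y} ks → decidable-stable (X ≟ₚ Y) λ X≢Y → none (Y , ks , X≢Y))
  (λ uniq (Y , ks , X≢Y) → X≢Y (uniq ks))
  (¬? (anyPair? λ Y → isKSPartition? G Y ×-dec ¬? (X ≟ₚ Y)))

isKSPartition-resp : ∀ X → RespectsAdj {n} (λ G → IsKSPartition G X)
isKSPartition-resp X _ _ eq (∪≡⊤ , ∩≡⊥ , clique , stable) =
  ∪≡⊤ , ∩≡⊥
  , (λ i j i∈ j∈ i≢j → subst T (eq i j) (clique i j i∈ j∈ i≢j))
  , (λ i j i∈ j∈ → stable i j i∈ j∈ ∘ subst T (sym (eq i j)))

split-resp : RespectsAdj {n} Split
split-resp G H eq (X , ks) = X , isKSPartition-resp X G H eq ks

balanced-resp : RespectsAdj {n} Balanced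
balanced-resp G H eq (X , ks , uniq) = X , isKSPartition-resp X G H eq ks ,
  λ {Y} ks′ → uniq (isKSPartition-resp Y H G (λ i j → sym (eq i j)) ks′)

-- A size is determined by its bijection, so the enumerations that produce these
-- two are kept opaque.
abstract
  split-size : ∀ n → ∃ (HasSize (Unlabeled n Split))
  split-size n = unlabeled-size split-resp split?

  unbalanced-size : ∀ n → ∃ (HasSize (Unlabeled n Unbalanced))
  unbalanced-size n = unlabeled-size
    (λ G H eq (s , ¬b) → split-resp G H eq s , ¬b ∘ balanced-resp H G (λ i j → sym (eq i j)))
    (λ G → split? G ×-dec ¬? (balanced? G))

------------------------------------------------------------------------
-- The numbers of unlabeled split and unbalanced split graphs

#split : ℕ → ℕ
#split n = proj₁ (split-size n)

#unbalanced : ℕ → ℕ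
#unbalanced n = proj₁ (unbalanced-size n)

private
  edgeless : (n : ℕ) → Graph n
  edgeless n = record
    { adj = λ _ _ → false ; adj-sym = λ _ _ → refl ; adj-irrefl = λ _ → refl }

  edgeless-split : Split (edgeless n)
  edgeless-split = (⊥ , ⊤) , ∪-identityˡ ⊤ , ∩-zeroˡ ⊤
                 , (λ _ _ i∈⊥ → contradiction i∈⊥ ∉⊥) , (λ _ _ _ _ ())

  Fin⇒nonZero : ∀ {k} → Fin k → NonZero k
  Fin⇒nonZero {ℕ.suc _} _ = _

instance
  #split-nonZero : ∀ {n} → NonZero (#split n)
  #split-nonZero {n} =
    Fin⇒nonZero (Inverse.to (proj₂ (split-size n)) (edgeless n , edgeless-split))

------------------------------------------------------------------------
-- Limits of rational sequences

-- For a rational limit, it makes no difference whether ε ranges over the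
-- positive rationals or the positive reals.
infix 4 _⟶_

_⟶_ : (ℕ → ℚ) → ℚ → Set
a ⟶ L = ∀ ε → 0ℚ < ε → ∃ λ N → ∀ n → n ≥ N → ∣ a n - L ∣ < ε

{-# OPTIONS --safe #-}

-- An unbalanced split graph has a KS-partition (K , S) and a vertex v of S
-- adjacent to all of K. Replacing the neighbourhood of v by subsets of K gives
-- many split graphs, and such a graph G′, together with the image of v and the
-- KS-partition, returns G. Since any two KS-partitions differ by at most one
-- vertex each way, this information costs only a polynomial factor.
--
-- Automorphisms could make these extensions isomorphic. Fix r = O(log n)
-- vertices R of S and call the adjacencies of x to R its trace. If K has d
-- vertices with distinct traces, the 2 ^ d neighbourhoods that are unions of
-- trace classes give extensions that are pairwise non-isomorphic over v, K and
-- R, so at least 2 ^ d / n ^ O(r) isomorphism classes. If K has fewer than d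
-- traces, then about r n / 2 bits of the adjacency matrix are redundant; this
-- saving beats the factor n ^ n lost when the number of isomorphism classes is
-- bounded below by the number of labeled graphs over n ^ n. Hence
-- n * #unbalanced n ≤ #split n for large n.
module Submission where

open import Defs
open import Data.Bool.Base using (Bool; true; false; _∧_; _∨_; not; if_then_else_)
open import Data.Bool.Properties as Bool using (T-≡; ∧-zeroʳ; ¬-not)
open import Data.Empty using (⊥)
open import Data.Fin.Base
  using (Fin; zero; suc; toℕ; fromℕ<; combine; join; splitAt; _↑ˡ_; _↑ʳ_; finToFun; funToFin)
open import Data.Fin.Permutation using (_⟨$⟩ʳ_; _⟨$⟩ˡ_; inverseʳ; inverseˡ)
open import Data.Fin.Properties as Fin using (_≟_; any?; all?; 2↔Bool; finToFun-funToFin; *↔×; +↔⊎)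
open import Data.Fin.Subset using (Subset; _∈_)
open import Data.Integer.Base as ℤ using (+_; -[1+_]; +[1+_])
import Data.Integer.Properties as ℤ
open import Data.Nat.Base
  using (ℕ; zero; suc; _+_; _*_; _^_; _∸_; _<_; _≤_; z≤n; s≤s; _≤′_; ≤′-reflexive; ≤′-step;
         ⌊_/2⌋; ⌈_/2⌉; NonZero; >-nonZero⁻¹)
import Data.Nat.Properties as ℕ
open import Data.Nat.Tactic.RingSolver using (solve-∀)
open import Data.Product using (Σ; ∃; ∃₂; _×_; _,_; proj₁; proj₂)
open import Data.Product.Function.NonDependent.Propositional using (_×-↔_)
open import Data.Rational.Base as ℚ using (mkℚ; 0ℚ; _/_; ↧ₙ_)
import Data.Rational.Properties as ℚ
open import Data.Rational.Unnormalised.Base as ℚᵘ using (mkℚᵘ)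
import Data.Rational.Unnormalised.Properties as ℚᵘ
open import Data.Sum.Base using (_⊎_; inj₁; inj₂)
open import Data.Sum.Function.Propositional using (_⊎-↔_)
open import Data.Vec.Base using (Vec; lookup; tabulate)
import Data.Vec.Properties as Vec
open import Function.Base using (_∘_)
open import Function.Bundles using (Inverse; Equivalence; _↔_)
open import Function.Construct.Composition using (_↔-∘_)
open import Function.Construct.Identity using (↔-id)
open import Function.Construct.Symmetry using (↔-sym)
open import Relation.Binary.PropositionalEquality
open import Relation.Nullary.Decidable
  using (Dec; yes; no; does; ¬?; _×-dec_; decidable-stable; dec-true; dec-false)
open import Relation.Nullary.Negation using (contradiction)

private
  variable
    n d r : ℕ

-- Bit vectors and functions coded as elements of finite sets

lookup-ext : {A : Set} (xs ys : Vec A n) → (∀ i → lookup xs i ≡ lookup ys i) → xs ≡ ys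
lookup-ext xs ys eq = trans (sym (Vec.tabulate∘lookup xs))
  (trans (Vec.tabulate-cong eq) (Vec.tabulate∘lookup ys))

bits : Fin (2 ^ n) → Fin n → Bool
bits {n} c x = Inverse.to 2↔Bool (finToFun {2} {n} c x)

fromBits : (Fin n → Bool) → Fin (2 ^ n)
fromBits {n} f = funToFin {n} {2} (Inverse.from 2↔Bool ∘ f)

bits-fromBits : (f : Fin n → Bool) → ∀ x → bits (fromBits f) x ≡ f x
bits-fromBits f x = trans (cong (Inverse.to 2↔Bool) (finToFun-funToFin _ x))
                          (Inverse.strictlyInverseˡ 2↔Bool (f x))

funToFin-cong : {f g : Fin n → Fin d} → (∀ x → f x ≡ g x) → funToFin f ≡ funToFin g
funToFin-cong {zero}  _  = refl
funToFin-cong {suc n} eq = cong₂ combine (eq zero) (funToFin-cong (eq ∘ suc))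

finToFun-injective : (c e : Fin (d ^ n)) → (∀ x → finToFun {d} {n} c x ≡ finToFun {d} {n} e x) → c ≡ e
finToFun-injective {d} {n} c e eq = begin
  c                              ≡⟨ Fin.funToFin-finToFin {n} {d} c ⟨
  funToFin (finToFun {d} {n} c)  ≡⟨ funToFin-cong eq ⟩
  funToFin (finToFun {d} {n} e)  ≡⟨ Fin.funToFin-finToFin {n} {d} e ⟩
  e                              ∎
  where open ≡-Reasoning

bits-injective : (c e : Fin (2 ^ n)) → (∀ x → bits c x ≡ bits e x) → c ≡ e
bits-injective {n} c e eq = finToFun-injective {2} {n} c e λ x →
  trans (sym (Inverse.strictlyInverseʳ 2↔Bool _))
  (trans (cong (Inverse.from 2↔Bool) (eq x)) (Inverse.strictlyInverseʳ 2↔Bool _))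

fromBits-cong : {f g : Fin n → Bool} → (∀ x → f x ≡ g x) → fromBits f ≡ fromBits g
fromBits-cong eq = funToFin-cong (cong (Inverse.from 2↔Bool) ∘ eq)

-- KS-partitions given by their clique side

-- κ is the indicator function of the clique side of a KS-partition.
record IsPart (G : Graph n) (κ : Fin n → Bool) : Set where
  field
    clique : ∀ {x y} → κ x ≡ true → κ y ≡ true → x ≢ y → adj G x y ≡ true
    stable : ∀ {x y} → κ x ≡ false → κ y ≡ false → adj G x y ≡ false

open IsPart

-- Distinct `x` and `y` would be adjacent by the first partition and nonadjacent by the second.
clique∩stable : {G : Graph n} {κ κ′ : Fin n → Bool} → IsPart G κ → IsPart G κ′ →
  ∀ {x y} → κ x ≡ true → κ y ≡ true → κ′ x ≡ false → κ′ y ≡ false → x ≡ y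
clique∩stable p p′ {x} {y} κx κy κ′x κ′y = decidable-stable (x ≟ y) λ x≢y →
  contradiction (trans (sym (clique p κx κy x≢y)) (stable p′ κ′x κ′y)) λ ()

isPart-cong : {G : Graph n} {κ κ′ : Fin n → Bool} → (∀ x → κ′ x ≡ κ x) → IsPart G κ → IsPart G κ′
isPart-cong eq p = record
  { clique = λ κx κy → clique p (trans (sym (eq _)) κx) (trans (sym (eq _)) κy)
  ; stable = λ κx κy → stable p (trans (sym (eq _)) κx) (trans (sym (eq _)) κy)
  }

toSplit : {G : Graph n} {κ : Fin n → Bool} → IsPart G κ → Split G
toSplit {n} {G} {κ} p = (tabulate κ , tabulate (not ∘ κ))
  , lookup-ext _ _ (λ i → trans (Vec.lookup-zipWith _∨_ i (tabulate κ) _)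
      (trans (cong₂ _∨_ (Vec.lookup∘tabulate κ i) (Vec.lookup∘tabulate (not ∘ κ) i))
             (trans (Bool.∨-inverseʳ (κ i)) (sym (Vec.lookup-replicate i true)))))
  , lookup-ext _ _ (λ i → trans (Vec.lookup-zipWith _∧_ i (tabulate κ) _)
      (trans (cong₂ _∧_ (Vec.lookup∘tabulate κ i) (Vec.lookup∘tabulate (not ∘ κ) i))
             (trans (Bool.∧-inverseʳ (κ i)) (sym (Vec.lookup-replicate i false)))))
  , (λ i j i∈ j∈ i≢j → Equivalence.from T-≡ (clique p (value κ i∈) (value κ j∈) i≢j))
  , (λ i j i∈ j∈ adj → contradiction
      (trans (sym (Equivalence.to T-≡ adj)) (stable p (value′ i∈) (value′ j∈))) λ ())
  where
  value : ∀ (f : Fin n → Bool) {i} → i ∈ tabulate f → f i ≡ true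
  value f {i} i∈ = trans (sym (Vec.lookup∘tabulate f i)) (Vec.[]=⇒lookup i∈)
  value′ : ∀ {i} → i ∈ tabulate (not ∘ κ) → κ i ≡ false
  value′ i∈ = trans (sym (Bool.not-involutive _)) (cong not (value (not ∘ κ) i∈))

module _ {G : Graph n} {K S : Subset n} (ks : IsKSPartition G (K , S)) where

  side : ∀ i → lookup S i ≡ not (lookup K i)
  side i = complement (lookup K i) (lookup S i)
    (trans (sym (Vec.lookup-zipWith _∨_ i K S))
           (trans (cong (λ X → lookup X i) (proj₁ ks)) (Vec.lookup-replicate i true)))
    (trans (sym (Vec.lookup-zipWith _∧_ i K S))
           (trans (cong (λ X → lookup X i) (proj₁ (proj₂ ks))) (Vec.lookup-replicate i false)))
    where
    complement : ∀ k s → k ∨ s ≡ true → k ∧ s ≡ false → s ≡ not k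
    complement true  s     _ eq = eq
    complement false s     eq _ = eq

  fromKS : IsPart G (lookup K)
  fromKS = record
    { clique = λ {x} {y} κx κy x≢y → Equivalence.to T-≡
        (proj₁ (proj₂ (proj₂ ks)) x y (Vec.lookup⇒[]= x K κx) (Vec.lookup⇒[]= y K κy) x≢y)
    ; stable = λ {x} {y} κx κy → ¬-not λ eq →
        proj₂ (proj₂ (proj₂ ks)) x y
          (Vec.lookup⇒[]= x S (trans (side x) (cong not κx)))
          (Vec.lookup⇒[]= y S (trans (side y) (cong not κy))) (Equivalence.from T-≡ eq)
    }

-- Swing vertices

-- Every unbalanced split graph has such a v; v is the swing vertex placed on
-- the stable side.
record Swing (G : Graph n) : Set where
  field
    set  : Fin (2 ^ n)
    v    : Fin n

  κ : Fin n → Bool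
  κ = bits set

  field
    part : IsPart G κ
    κv   : κ v ≡ false
    full : ∀ x → adj G v x ≡ κ x

mkSwing : {G : Graph n} {κ : Fin n → Bool} → IsPart G κ → (v : Fin n) →
          κ v ≡ false → (∀ x → κ x ≡ true → adj G v x ≡ true) → Swing G
mkSwing {G = G} {κ} p v κv full = record
  { set  = fromBits κ
  ; v    = v
  ; part = isPart-cong (bits-fromBits κ) p
  ; κv   = trans (bits-fromBits κ v) κv
  ; full = λ x → trans (full′ x) (sym (bits-fromBits κ x))
  }
  where
  full′ : ∀ x → adj G v x ≡ κ x
  full′ x with κ x in eq
  ... | true  = full x eq
  ... | false = stable p κv eq

-- If `x` has a neighbour `y` on the stable side of `κ`, then `y` lies in the clique of `κ′`, as
-- does every clique vertex of `κ` other than `x`; so `y` is a swing vertex. If there is no such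
-- `y`, moving `x` to the stable side makes `x` one.
twoParts⇒swing : {G : Graph n} {κ κ′ : Fin n → Bool} → IsPart G κ → IsPart G κ′ →
                 ∀ x → κ x ≡ true → κ′ x ≡ false → Swing G
twoParts⇒swing {n} {G} {κ} {κ′} p p′ x κx κ′x
  with any? (λ y → κ y Bool.≟ false ×-dec adj G x y Bool.≟ true)
... | yes (y , κy , xy) = mkSwing p y κy λ z κz → adjacent z κz (z ≟ x)
  where
  κ′y : κ′ y ≡ true
  κ′y = ¬-not λ κ′y → contradiction (trans (sym xy) (stable p′ κ′x κ′y)) λ ()
  adjacent : ∀ z → κ z ≡ true → Dec (z ≡ x) → adj G y z ≡ true
  adjacent z κz (yes refl) = trans (adj-sym G y z) xy
  adjacent z κz (no z≢x)   = clique p′ κ′y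
    (¬-not λ κ′z → z≢x (clique∩stable p p′ κz κx κ′z κ′x))
    λ { refl → contradiction (trans (sym κz) κy) λ () }
... | no isolated = mkSwing p⁻ x κ⁻x λ y κ⁻y → clique p κx (κ⁻⇒κ κ⁻y) λ { refl →
    contradiction (trans (sym κ⁻y) κ⁻x) λ () }
  where
  κ⁻ : Fin n → Bool
  κ⁻ y = κ y ∧ not (does (y ≟ x))
  κ⁻x : κ⁻ x ≡ false
  κ⁻x = trans (cong (λ b → κ x ∧ not b) (dec-true (x ≟ x) refl)) (∧-zeroʳ (κ x))
  κ⁻⇒κ : ∀ {y} → κ⁻ y ≡ true → κ y ≡ true
  κ⁻⇒κ {y} eq with κ y
  ... | true  = refl
  ... | false = eq
  outside : ∀ y → κ⁻ y ≡ false → y ≡ x ⊎ κ y ≡ false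
  outside y eq with κ y | y ≟ x
  ... | false | _      = inj₂ refl
  ... | true  | yes y≡ = inj₁ y≡
  ... | true  | no  _  = contradiction eq λ ()
  nonadjacent : ∀ y → κ y ≡ false → adj G x y ≡ false
  nonadjacent y κy = ¬-not λ xy → isolated (y , κy , xy)
  p⁻ : IsPart G κ⁻
  p⁻ = record
    { clique = λ κy κz → clique p (κ⁻⇒κ κy) (κ⁻⇒κ κz)
    ; stable = λ {y} {z} κ⁻y κ⁻z → stable⁻ (outside y κ⁻y) (outside z κ⁻z)
    }
    where
    stable⁻ : ∀ {y z} → y ≡ x ⊎ κ y ≡ false → z ≡ x ⊎ κ z ≡ false → adj G y z ≡ false
    stable⁻ (inj₁ refl) (inj₁ refl) = adj-irrefl G x
    stable⁻ (inj₁ refl) (inj₂ κz)   = nonadjacent _ κz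
    stable⁻ (inj₂ κy)   (inj₁ refl) = trans (adj-sym G _ x) (nonadjacent _ κy)
    stable⁻ (inj₂ κy)   (inj₂ κz)   = stable p κy κz

-- The failure of uniqueness supplies no second partition, so a finite search looks for a vertex
-- that some partition places differently. If none exists, the given partition is unique.
unbalanced⇒swing : {G : Graph n} → Unbalanced G → Swing G
unbalanced⇒swing {n} {G} (((K , S) , ks) , ¬balanced) = choose (differs? true false) (differs? false true)
  where
  Differs : Bool → Bool → Set
  Differs b c = ∃ λ x → lookup K x ≡ b × ∃ λ X → IsKSPartition G X × lookup (proj₁ X) x ≡ c

  differs? : ∀ b c → Dec (Differs b c)
  differs? b c = any? λ x → lookup K x Bool.≟ b ×-dec
    anyPair? λ X → isKSPartition? G X ×-dec lookup (proj₁ X) x Bool.≟ c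

  choose : Dec (Differs true false) → Dec (Differs false true) → Swing G
  choose (yes (x , κx , _ , ks′ , κ′x)) _ = twoParts⇒swing (fromKS ks) (fromKS ks′) x κx κ′x
  choose _ (yes (x , κx , _ , ks′ , κ′x)) = twoParts⇒swing (fromKS ks′) (fromKS ks) x κ′x κx
  choose (no none) (no none′) = contradiction balanced ¬balanced
    where
    same : ∀ {X} → IsKSPartition G X → ∀ x → lookup K x ≡ lookup (proj₁ X) x
    same {X} ks′ x with lookup K x in κx | lookup (proj₁ X) x in κ′x
    ... | true  | true  = refl
    ... | false | false = refl
    ... | true  | false = contradiction (x , κx , X , ks′ , κ′x) none
    ... | false | true  = contradiction (x , κx , X , ks′ , κ′x) none′

    unique : ∀ {X} → IsKSPartition G X → (K , S) ≡ X
    unique {K′ , S′} ks′ = cong₂ _,_ (lookup-ext K K′ (same {K′ , S′} ks′))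
      (lookup-ext S S′ λ i → trans (side {G = G} ks i) (trans (cong not (same {K′ , S′} ks′ i)) (sym (side {G = G} ks′ i))))

    balanced : Balanced G
    balanced = (K , S) , ks , λ {X} → unique {X}

-- Counting by codes, and representatives of classes

-- Each `z` encodes at most one `x`, so any choice of codes is injective. A relation suffices
-- because an element may have many codes.
encoding⇒≤ : ∀ {a b} {A B : Set} → Fin a ↔ A → B ↔ Fin b → (_encodes_ : B → A → Set) →
  (∀ x → ∃ λ z → z encodes x) → (∀ {x y z} → z encodes x → z encodes y → x ≡ y) → a ≤ b
encoding⇒≤ A↔ B↔ _encodes_ code unique = Fin.injective⇒≤ {f = f} λ {i} {j} eq →
  Inverse-injective A↔ (unique (proj₂ (code (Inverse.to A↔ i)))
    (subst (_encodes _) (sym (Inverse-injective B↔ eq)) (proj₂ (code (Inverse.to A↔ j)))))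
  where
  f : Fin _ → Fin _
  f i = Inverse.to B↔ (proj₁ (code (Inverse.to A↔ i)))
  Inverse-injective : {A B : Set} (e : A ↔ B) {x y : A} → Inverse.to e x ≡ Inverse.to e y → x ≡ y
  Inverse-injective e eq = trans (sym (Inverse.strictlyInverseʳ e _))
    (trans (cong (Inverse.from e) eq) (Inverse.strictlyInverseʳ e _))

class : (G : Graph n) → Split G → Fin (#split n)
class {n} G s = Inverse.to (proj₂ (split-size n)) (G , s)

rep : Fin (#split n) → Graph n
rep {n} z = proj₁ (Inverse.from (proj₂ (split-size n)) z)

≅-rep-class : (G : Graph n) (s : Split G) → G ≅ rep (class G s)
≅-rep-class {n} G s = ≅-sym {G = rep (class G s)} {G}
  (Inverse.strictlyInverseʳ (proj₂ (split-size n)) (G , s))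

repκ : Fin (#split n) → Fin n → Bool
repκ {n} z = lookup (proj₁ (proj₁ (proj₂ (Inverse.from (proj₂ (split-size n)) z))))

repκ-isPart : (z : Fin (#split n)) → IsPart (rep z) (repκ z)
repκ-isPart {n} z = fromKS (proj₂ (proj₂ (Inverse.from (proj₂ (split-size n)) z)))

-- Lower bound for the number of split graphs

-- An isomorphism class contains at most (k + m) ^ (k + m) labeled graphs.
module _ (k m : ℕ) where

  private
    V : Set
    V = Fin k ⊎ Fin m

    -- The bits form the bipartite adjacency matrix between a clique on `k` vertices and a stable
    -- set on `m` vertices, so distinct codes give distinct labeled graphs.
    matrixAdj : Fin (2 ^ (k * m)) → V → V → Bool
    matrixAdj c (inj₁ i) (inj₁ j) = not (does (i ≟ j))
    matrixAdj c (inj₁ i) (inj₂ j) = bits c (combine i j)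
    matrixAdj c (inj₂ i) (inj₁ j) = bits c (combine j i)
    matrixAdj c (inj₂ i) (inj₂ j) = false

    matrixAdj-sym : ∀ c x y → matrixAdj c x y ≡ matrixAdj c y x
    matrixAdj-sym c (inj₁ i) (inj₂ j) = refl
    matrixAdj-sym c (inj₂ i) (inj₁ j) = refl
    matrixAdj-sym c (inj₂ i) (inj₂ j) = refl
    matrixAdj-sym c (inj₁ i) (inj₁ j) with i ≟ j
    ... | yes refl = sym (cong not (dec-true (j ≟ j) refl))
    ... | no i≢j   = sym (cong not (dec-false (j ≟ i) (i≢j ∘ sym)))

    matrixAdj-irrefl : ∀ c x → matrixAdj c x x ≡ false
    matrixAdj-irrefl c (inj₁ i) = cong not (dec-true (i ≟ i) refl)
    matrixAdj-irrefl c (inj₂ i) = refl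

    inClique : V → Bool
    inClique (inj₁ _) = true
    inClique (inj₂ _) = false

    matrixGraph : Fin (2 ^ (k * m)) → Graph (k + m)
    matrixGraph c = record
      { adj        = λ x y → matrixAdj c (splitAt k x) (splitAt k y)
      ; adj-sym    = λ x y → matrixAdj-sym c (splitAt k x) (splitAt k y)
      ; adj-irrefl = λ x → matrixAdj-irrefl c (splitAt k x)
      }

    matrix-isPart : ∀ c → IsPart (matrixGraph c) (inClique ∘ splitAt k)
    matrix-isPart c = record
      { clique = λ {x} {y} κx κy x≢y → clique′ _ _ κx κy λ eq → x≢y
          (trans (sym (Fin.join-splitAt k m x)) (trans (cong (join k m) eq) (Fin.join-splitAt k m y)))
      ; stable = λ {x} {y} → stable′ (splitAt k x) (splitAt k y)
      }
      where
      clique′ : ∀ x y → inClique x ≡ true → inClique y ≡ true → x ≢ y → matrixAdj c x y ≡ true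
      clique′ (inj₁ i) (inj₁ j) _ _ x≢y = cong not (dec-false (i ≟ j) (x≢y ∘ cong inj₁))
      stable′ : ∀ x y → inClique x ≡ false → inClique y ≡ false → matrixAdj c x y ≡ false
      stable′ (inj₂ _) (inj₂ _) _ _ = refl

    entry : ∀ c i j → adj (matrixGraph c) (i ↑ˡ m) (k ↑ʳ j) ≡ bits c (combine i j)
    entry c i j = cong₂ (matrixAdj c) (Fin.splitAt-↑ˡ k i m) (Fin.splitAt-↑ʳ k m j)

    -- The isomorphism onto the representative is stored as a mere function; pulling the
    -- representative back along it recovers the matrix.
    _encodes_ : Fin (#split (k + m)) × Fin ((k + m) ^ (k + m)) → Fin (2 ^ (k * m)) → Set
    (z , f) encodes c =
      Σ (matrixGraph c ≅ rep z) λ (π , _) → ∀ x → finToFun {k + m} {k + m} f x ≡ π ⟨$⟩ʳ x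

  2^*≤#split*^ : 2 ^ (k * m) ≤ #split (k + m) * (k + m) ^ (k + m)
  2^*≤#split*^ = encoding⇒≤ (↔-id _) (↔-sym *↔×) _encodes_ code unique
    where
    code : ∀ c → ∃ (_encodes c)
    code c = (class (matrixGraph c) s , funToFin (π ⟨$⟩ʳ_)) , iso , finToFun-funToFin (π ⟨$⟩ʳ_)
      where
      s   = toSplit (matrix-isPart c)
      iso = ≅-rep-class (matrixGraph c) s
      π   = proj₁ iso

    unique : ∀ {c e z} → z encodes c → z encodes e → c ≡ e
    unique {c} {e} {z , _} ((π , c≅) , f≡π) ((ρ , e≅) , f≡ρ) = bits-injective c e λ l →
      subst (λ l → bits c l ≡ bits e l) (Fin.combine-remQuot {k} m l)
        (trans (sym (entry c _ _)) (trans (same _ _) (entry e _ _)))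
      where
      π≡ρ : ∀ x → π ⟨$⟩ʳ x ≡ ρ ⟨$⟩ʳ x
      π≡ρ x = trans (sym (f≡π x)) (f≡ρ x)
      same : ∀ x y → adj (matrixGraph c) x y ≡ adj (matrixGraph e) x y
      same x y = trans (c≅ x y) (trans (cong₂ (adj (rep z)) (π≡ρ x) (π≡ρ y)) (sym (e≅ x y)))

-- Transport and comparison of KS-partitions

isPart-≅ : {G H : Graph n} {κ : Fin n → Bool} → ((π , _) : G ≅ H) → IsPart G κ →
           IsPart H (κ ∘ (π ⟨$⟩ˡ_))
isPart-≅ {G = G} {H} (π , eq) p = record
  { clique = λ {x} {y} κx κy x≢y → trans (eq′ x y) (clique p κx κy λ πx≡πy → x≢y
      (trans (sym (inverseʳ π)) (trans (cong (π ⟨$⟩ʳ_) πx≡πy) (inverseʳ π))))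
  ; stable = λ {x} {y} κx κy → trans (eq′ x y) (stable p κx κy)
  }
  where
  eq′ : ∀ x y → adj H x y ≡ adj G (π ⟨$⟩ˡ x) (π ⟨$⟩ˡ y)
  eq′ = proj₂ (≅-sym {G = G} {H} (π , eq))

-- Two KS-partitions differ by moving at most one vertex each way; here zero
-- stands for no vertex.
move : (κ : Fin n → Bool) (a b : Fin (suc n)) → Fin n → Bool
move κ a b x = if does (suc x ≟ b) then true else if does (suc x ≟ a) then false else κ x

index-unique : {P : Fin n → Set} → (∀ x → Dec (P x)) → (∀ {x y} → P x → P y → x ≡ y) →
  ∃ λ (a : Fin (suc n)) → ∀ x → (P x → suc x ≡ a) × (suc x ≡ a → P x)
index-unique P? unique with any? P?
... | yes (x , px) = suc x , λ y → (λ py → cong suc (unique py px)) , λ { refl → px }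
... | no none      = zero , λ y → (λ py → contradiction (y , py) none) , λ ()

-- By `clique∩stable`, at most one vertex `a` leaves the clique side and at most one vertex `b`
-- enters it.
isPart-move : {G : Graph n} {κ κ′ : Fin n → Bool} → IsPart G κ → IsPart G κ′ →
              ∃₂ λ a b → ∀ x → κ′ x ≡ move κ a b x
isPart-move {κ = κ} {κ′} p p′
  with index-unique (λ x → κ x Bool.≟ true ×-dec κ′ x Bool.≟ false)
         (λ (κx , κ′x) (κy , κ′y) → clique∩stable p p′ κx κy κ′x κ′y)
     | index-unique (λ x → κ′ x Bool.≟ true ×-dec κ x Bool.≟ false)
         (λ (κ′x , κx) (κ′y , κy) → clique∩stable p′ p κ′x κ′y κx κy)
... | a , left | b , entered = a , b , moved
  where
  moved : ∀ x → κ′ x ≡ move κ a b x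
  moved x with suc x ≟ b
  ... | yes ≡b = proj₁ (proj₂ (entered x) ≡b)
  ... | no ≢b with suc x ≟ a
  ...   | yes ≡a = proj₂ (proj₂ (left x) ≡a)
  ...   | no ≢a with κ x in κx | κ′ x in κ′x
  ...     | true  | true  = refl
  ...     | false | false = refl
  ...     | true  | false = contradiction (proj₁ (left x) (κx , κ′x)) ≢a
  ...     | false | true  = contradiction (proj₁ (entered x) (κ′x , κx)) ≢b

-- Reattaching the swing vertex

module _ {G : Graph n} (sw : Swing G) where
  open Swing sw

  -- The new neighbourhood of `v` stays inside the clique side, so `κ` remains a KS-partition. The
  -- equality decisions are arguments of `adj′` so that its symmetry follows by matching on both.
  reattach : (Fin n → Bool) → Graph n
  reattach c = record
    { adj        = λ x y → adj′ x y (x ≟ v) (y ≟ v)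
    ; adj-sym    = λ x y → adj′-sym x y (x ≟ v) (y ≟ v)
    ; adj-irrefl = λ x → adj′-irrefl x (x ≟ v)
    }
    where
    adj′ : ∀ x y → Dec (x ≡ v) → Dec (y ≡ v) → Bool
    adj′ x y (yes _) _       = κ y ∧ c y
    adj′ x y (no _)  (yes _) = κ x ∧ c x
    adj′ x y (no _)  (no _)  = adj G x y
    adj′-sym : ∀ x y dx dy → adj′ x y dx dy ≡ adj′ y x dy dx
    adj′-sym x y (yes refl) (yes refl) = refl
    adj′-sym x y (yes _) (no _)  = refl
    adj′-sym x y (no _)  (yes _) = refl
    adj′-sym x y (no _)  (no _)  = adj-sym G x y
    adj′-irrefl : ∀ x dx → adj′ x x dx dx ≡ false
    adj′-irrefl x (yes refl) = cong (_∧ c x) κv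
    adj′-irrefl x (no _)     = adj-irrefl G x

  reattach-v : ∀ c x → adj (reattach c) v x ≡ κ x ∧ c x
  reattach-v c x with v ≟ v
  ... | yes _   = refl
  ... | no v≢v = contradiction refl v≢v

  reattach-≢v : ∀ c {x y} → x ≢ v → y ≢ v → adj (reattach c) x y ≡ adj G x y
  reattach-≢v c {x} {y} x≢v y≢v with x ≟ v | y ≟ v
  ... | yes x≡v | _       = contradiction x≡v x≢v
  ... | no _    | yes y≡v = contradiction y≡v y≢v
  ... | no _    | no _    = refl

  κ⇒≢v : ∀ {x} → κ x ≡ true → x ≢ v
  κ⇒≢v κx refl = contradiction (trans (sym κx) κv) λ ()

  reattach-isPart : ∀ c → IsPart (reattach c) κ
  reattach-isPart c = record
    { clique = λ κx κy x≢y → trans (reattach-≢v c (κ⇒≢v κx) (κ⇒≢v κy)) (clique part κx κy x≢y)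
    ; stable = stable′
    }
    where
    stable′ : ∀ {x y} → κ x ≡ false → κ y ≡ false → adj (reattach c) x y ≡ false
    stable′ {x} {y} κx κy with x ≟ v | y ≟ v
    ... | yes _ | _     = cong (_∧ c y) κy
    ... | no _  | yes _ = cong (_∧ c x) κx
    ... | no _  | no _  = stable part κx κy

  -- (a , b) locates the clique side inside the representative of the class z.
  Mark : ∀ {z} → (Fin n → Bool) → (Fin r → Fin n) →
         Fin n × (Fin (suc n) × Fin (suc n)) × Fin (n ^ r) → Set
  Mark {r} {z} c R (u , (a , b) , f) = Σ (reattach c ≅ rep z) λ (π , _) →
    π ⟨$⟩ʳ v ≡ u × (∀ x → κ x ≡ move (repκ z) a b (π ⟨$⟩ʳ x)) ×
    (∀ l → π ⟨$⟩ʳ (R l) ≡ finToFun {n} {r} f l)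

  mark : ∀ c (R : Fin r → Fin n) → ∃₂ λ z t → Mark {z = z} c R t
  mark c R = class H s , (π ⟨$⟩ʳ v , (a , b) , funToFin (λ l → π ⟨$⟩ʳ R l))
    , iso , refl , (λ x → trans (cong κ (sym (inverseˡ π))) (moved (π ⟨$⟩ʳ x)))
    , λ l → sym (finToFun-funToFin _ l)
    where
    H   = reattach c
    s   = toSplit (reattach-isPart c)
    iso = ≅-rep-class H s
    π   = proj₁ iso
    -- The partition carried along the isomorphism differs by a move from the one stored with the
    -- representative, so locating it takes only two elements of `Fin (suc n)`.
    near = isPart-move (repκ-isPart (class H s)) (isPart-≅ {G = H} iso (reattach-isPart c))
    a   = proj₁ near
    b   = proj₁ (proj₂ near)
    moved = proj₂ (proj₂ near)

open Swing

record _≅ₘ_ {G H : Graph n} (A : Swing G × (Fin n → Bool) × (Fin r → Fin n))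
                             (B : Swing H × (Fin n → Bool) × (Fin r → Fin n)) : Set where
  field
    iso : reattach (proj₁ A) (proj₁ (proj₂ A)) ≅ reattach (proj₁ B) (proj₁ (proj₂ B))

  θ : Fin n → Fin n
  θ = proj₁ iso ⟨$⟩ʳ_

  field
    θ-v : θ (v (proj₁ A)) ≡ v (proj₁ B)
    θ-κ : ∀ x → κ (proj₁ B) (θ x) ≡ κ (proj₁ A) x
    θ-R : ∀ l → θ (proj₂ (proj₂ A) l) ≡ proj₂ (proj₂ B) l

open _≅ₘ_

-- One isomorphism onto the representative is followed by the inverse of the other; equal marks make
-- the composite match `v`, the clique side and the tuples.
mark-unique : {G H : Graph n} (A : Swing G) (B : Swing H) {c e : Fin n → Bool} {R Q : Fin r → Fin n} →
  ∀ {z t} → Mark A {z = z} c R t → Mark B {z = z} e Q t → (A , c , R) ≅ₘ (B , e , Q)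
mark-unique A B {c} {e} {R} {Q} {z} {_ , (a , b) , _} (ι@(π , _) , πv , πκ , πR) (ι′@(ρ , _) , ρv , ρκ , ρR) = record
  { iso = ≅-trans {G = reattach A c} {rep z} {reattach B e} ι (≅-sym {G = reattach B e} {rep z} ι′)
  ; θ-v = meet (trans πv (sym ρv))
  ; θ-κ = λ x → trans (ρκ _) (trans (cong (move (repκ z) a b) (inverseʳ ρ)) (sym (πκ x)))
  ; θ-R = λ l → meet (trans (πR l) (sym (ρR l)))
  }
  where
  meet : ∀ {x y} → π ⟨$⟩ʳ x ≡ ρ ⟨$⟩ʳ y → ρ ⟨$⟩ˡ (π ⟨$⟩ʳ x) ≡ y
  meet eq = trans (cong (ρ ⟨$⟩ˡ_) eq) (inverseˡ ρ)

-- Away from the swing vertices reattaching changes nothing, and at them the original neighbourhood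
-- is the clique side, which `θ` preserves.
≅ₘ⇒≅ : {G H : Graph n} (A : Swing G) (B : Swing H) {c e : Fin n → Bool} {R Q : Fin r → Fin n} →
  (i : (A , c , R) ≅ₘ (B , e , Q)) → ∀ x y → adj G x y ≡ adj H (θ i x) (θ i y)
≅ₘ⇒≅ {n} {G = G} {H} A B {c} {e} i = same
  where
  θ≢v : ∀ {x} → x ≢ v A → θ i x ≢ v B
  θ≢v x≢v θx≡v = x≢v (trans (sym (inverseˡ π)) (trans (cong (π ⟨$⟩ˡ_) (trans θx≡v (sym (θ-v i)))) (inverseˡ π)))
    where π = proj₁ (iso i)
  from-v : ∀ y → adj G (v A) y ≡ adj H (θ i (v A)) (θ i y)
  from-v y = begin
    adj G (v A) y                ≡⟨ full A y ⟩
    κ A y                        ≡⟨ θ-κ i y ⟨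
    κ B (θ i y)                  ≡⟨ full B (θ i y) ⟨
    adj H (v B) (θ i y)          ≡⟨ cong (λ u → adj H u (θ i y)) (θ-v i) ⟨
    adj H (θ i (v A)) (θ i y)    ∎
    where open ≡-Reasoning
  same : ∀ x y → adj G x y ≡ adj H (θ i x) (θ i y)
  same x y with x ≟ v A | y ≟ v A
  ... | yes refl | _        = from-v y
  ... | no _     | yes refl = trans (adj-sym G x y) (trans (from-v x) (adj-sym H _ _))
  ... | no x≢v   | no y≢v   = begin
    adj G x y                              ≡⟨ reattach-≢v A c x≢v y≢v ⟨
    adj (reattach A c) x y                 ≡⟨ proj₂ (iso i) x y ⟩
    adj (reattach B e) (θ i x) (θ i y)     ≡⟨ reattach-≢v B e (θ≢v x≢v) (θ≢v y≢v) ⟩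
    adj H (θ i x) (θ i y)                  ∎
    where open ≡-Reasoning

-- Ranks within the two sides

count : Bool → Bool → ℕ
count b c = if does (b Bool.≟ c) then 1 else 0

count-refl : ∀ {b c} → b ≡ c → count b c ≡ 1
count-refl {b} refl = cong (if_then 1 else 0) (dec-true (b Bool.≟ b) refl)

size : ∀ {n} → (Fin n → Bool) → Bool → ℕ
size {zero}  κ b = 0
size {suc n} κ b = count (κ zero) b + size (κ ∘ suc) b

-- The rank of x among the vertices on its own side.
rank : ∀ {n} → (Fin n → Bool) → Fin n → ℕ
rank κ zero    = 0
rank κ (suc x) = count (κ zero) (κ (suc x)) + rank (κ ∘ suc) x

size-total : (κ : Fin n → Bool) → size κ true + size κ false ≡ n
size-total {zero}  κ = refl
size-total {suc n} κ with κ zero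
... | true  = cong suc (size-total (κ ∘ suc))
... | false = trans (ℕ.+-suc _ _) (cong suc (size-total (κ ∘ suc)))

rank<size : (κ : Fin n → Bool) → ∀ x → rank κ x < size κ (κ x)
rank<size κ zero    = subst (λ m → 0 < m + size (κ ∘ suc) (κ zero)) (sym (count-refl {κ zero} refl)) (s≤s z≤n)
rank<size κ (suc x) = ℕ.+-monoʳ-< (count (κ zero) (κ (suc x))) (rank<size (κ ∘ suc) x)

rank-injective : (κ : Fin n → Bool) → ∀ x y → κ x ≡ κ y → rank κ x ≡ rank κ y → x ≡ y
rank-injective κ zero    zero    _   _  = refl
rank-injective κ zero    (suc y) κ≡ eq = contradiction
  (trans eq (cong (_+ rank (κ ∘ suc) y) (count-refl κ≡))) λ ()
rank-injective κ (suc x) zero    κ≡ eq = contradiction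
  (trans (sym eq) (cong (_+ rank (κ ∘ suc) x) (count-refl (sym κ≡)))) λ ()
rank-injective κ (suc x) (suc y) κ≡ eq = cong suc (rank-injective (κ ∘ suc) x y κ≡
  (ℕ.+-cancelˡ-≡ (count (κ zero) (κ (suc y))) _ _
    (trans (cong (λ b → count (κ zero) b + rank (κ ∘ suc) x) (sym κ≡)) eq)))

-- Graphs with many distinct traces

-- Greedy choice: `d` distinct values either extend by a new one or already cover every value taken
-- on `P`.
distinct-or-covered : {A : Set} → A → (∀ (a b : A) → Dec (a ≡ b)) →
  {P : Fin n → Set} → (∀ x → Dec (P x)) → (f : Fin n → A) → ∀ d →
  (∃ λ (w : Fin d → Fin n) → (∀ j → P (w j)) × (∀ {i j} → f (w i) ≡ f (w j) → i ≡ j)) ⊎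
  (∃₂ λ (p : Fin n → Fin d) (g : Fin d → A) → ∀ x → P x → f x ≡ g (p x))
distinct-or-covered a₀ _≟′_ P? f zero = inj₁ ((λ ()) , (λ ()) , λ { {()} })
distinct-or-covered {n} {A} a₀ _≟′_ {P} P? f (suc d) with distinct-or-covered a₀ _≟′_ P? f d
... | inj₂ (p , g , covered) = inj₂ (suc ∘ p , (λ { zero → a₀ ; (suc j) → g j }) , covered)
... | inj₁ (w , Pw , distinct) = extend (any? λ x → P? x ×-dec all? λ j → ¬? (f x ≟′ f (w j)))
  where
  extend : Dec (∃ λ x → P x × ∀ j → f x ≢ f (w j)) → _
  extend (yes (x , Px , new)) = inj₁ (w′ , Pw′ , λ {i} {j} → distinct′ {i} {j})
    where
    w′ : Fin (suc d) → Fin n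
    w′ zero    = x
    w′ (suc j) = w j
    Pw′ : ∀ j → P (w′ j)
    Pw′ zero    = Px
    Pw′ (suc j) = Pw j
    distinct′ : ∀ {i j} → f (w′ i) ≡ f (w′ j) → i ≡ j
    distinct′ {zero}  {zero}  _  = refl
    distinct′ {zero}  {suc j} eq = contradiction eq (new j)
    distinct′ {suc i} {zero}  eq = contradiction (sym eq) (new i)
    distinct′ {suc i} {suc j} eq = cong suc (distinct eq)
  extend (no none) = inj₂ (p , g , covered)
    where
    old? : ∀ x → Dec (∃ λ j → f x ≡ f (w j))
    old? x = any? λ j → f x ≟′ f (w j)
    p : Fin n → Fin (suc d)
    p x with old? x
    ... | yes (j , _) = suc j
    -- Class `zero`, with the dummy value `a₀`, receives only vertices outside `P`.
    ... | no _        = zero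
    g : Fin (suc d) → A
    g zero    = a₀
    g (suc j) = f (w j)
    covered : ∀ x → P x → f x ≡ g (p x)
    covered x Px with old? x
    ... | yes (j , eq) = eq
    ... | no  not-old  = contradiction (x , Px , λ j eq → not-old (j , eq)) none

module _ (G : Graph n) (R : Fin r → Fin n) where

  trace : Fin n → Fin (2 ^ r)
  trace x = fromBits λ l → adj G x (R l)

record Rich (r d : ℕ) (G : Graph n) : Set where
  field
    swing    : Swing G
    R        : Fin r → Fin n
    w        : Fin d → Fin n
    κw       : ∀ j → κ swing (w j) ≡ true
    distinct : ∀ {i j} → trace G R (w i) ≡ trace G R (w j) → i ≡ j

  -- The union of the trace classes of those `w j` whose bit is set. Depending only on traces, it is
  -- respected by isomorphisms that fix `R`.
  select : Fin (2 ^ d) → Fin n → Bool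
  select e x = does (any? λ j → bits e j Bool.≟ true ×-dec trace G R x ≟ trace G R (w j))

  select-≡ : ∀ e {x j} → trace G R x ≡ trace G R (w j) → select e x ≡ bits e j
  select-≡ e {x} {j} x~w
    with any? (λ j → bits e j Bool.≟ true ×-dec trace G R x ≟ trace G R (w j))
  ... | yes (j′ , e≡ , x~w′) = trans (sym e≡) (cong (bits e) (distinct (trans (sym x~w′) x~w)))
  ... | no none = sym (¬-not λ e≡ → none (j , e≡ , x~w))

  -- The isomorphism need not fix `w j`, but it fixes `R` and is an automorphism of `G`, so it
  -- preserves the trace of `w j`. The adjacency of `v` to `w j` therefore reads bit `j` in both
  -- graphs.
  select-injective : ∀ {e e′} → (swing , select e , R) ≅ₘ (swing , select e′ , R) → e ≡ e′
  select-injective {e} {e′} i = bits-injective e e′ λ j → begin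
    bits e j                                                 ≡⟨ select-≡ e refl ⟨
    select e (w j)                                           ≡⟨ cong (_∧ select e (w j)) (κw j) ⟨
    κ swing (w j) ∧ select e (w j)                           ≡⟨ reattach-v swing (select e) (w j) ⟨
    adj (reattach swing (select e)) (v swing) (w j)          ≡⟨ proj₂ (iso i) (v swing) (w j) ⟩
    adj (reattach swing (select e′)) (θ i (v swing)) (θ i (w j))
      ≡⟨ cong (λ u → adj (reattach swing (select e′)) u (θ i (w j))) (θ-v i) ⟩
    adj (reattach swing (select e′)) (v swing) (θ i (w j))   ≡⟨ reattach-v swing (select e′) (θ i (w j)) ⟩
    κ swing (θ i (w j)) ∧ select e′ (θ i (w j))
      ≡⟨ cong₂ _∧_ (trans (θ-κ i (w j)) (κw j)) (select-≡ e′ (θ-trace (w j))) ⟩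
    bits e′ j                                                ∎
    where
    open ≡-Reasoning
    θ-trace : ∀ x → trace G R (θ i x) ≡ trace G R x
    θ-trace x = fromBits-cong λ l → trans (cong (adj G (θ i x)) (sym (θ-R i l)))
      (sym (≅ₘ⇒≅ swing swing i x (R l)))

-- Coding graphs with few traces

flat< : ∀ {a q i j} → i < a → j < q → q * i + j < a * q
flat< {a} {q} {i} {j} i<a j<q = begin-strict
  q * i + j  <⟨ ℕ.+-monoʳ-< (q * i) j<q ⟩
  q * i + q  ≡⟨ ℕ.+-comm (q * i) q ⟩
  q + q * i  ≡⟨ ℕ.*-suc q i ⟨
  q * suc i  ≤⟨ ℕ.*-monoʳ-≤ q i<a ⟩
  q * a      ≡⟨ ℕ.*-comm q a ⟩
  a * q      ∎
  where open ℕ.≤-Reasoning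

flat-injective : ∀ {a q i i′ j j′} → i < a → i′ < a → j < q → j′ < q →
                 q * i + j ≡ q * i′ + j′ → i ≡ i′ × j ≡ j′
flat-injective {a} {q} i< i′< j< j′< eq = let
    i≡ , j≡ = Fin.combine-injective (fromℕ< i<) (fromℕ< j<) (fromℕ< i′<) (fromℕ< j′<)
                (Fin.toℕ-injective (trans (value i< j<) (trans eq (sym (value i′< j′<)))))
  in Fin.fromℕ<-injective _ _ i< i′< i≡ , Fin.fromℕ<-injective _ _ j< j′< j≡
  where
  value : ∀ {i j} (i< : i < a) (j< : j < q) → toℕ (combine (fromℕ< i<) (fromℕ< j<)) ≡ q * i + j
  value i< j< = trans (Fin.toℕ-combine (fromℕ< i<) (fromℕ< j<))
    (cong₂ (λ i j → q * i + j) (Fin.toℕ-fromℕ< i<) (Fin.toℕ-fromℕ< j<))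

-- By `bound`, `N` bits hold the matrix between the clique side and the stable vertices left after
-- removing `r` of them, whatever the two sizes.
module Poor (n r d N : ℕ) (bound : ∀ a b → a + b + r ≡ n → a * b ≤ N) where

  -- (k , p , g , c) holds the clique side K, the trace class of each vertex, the
  -- trace of each class, and the adjacencies of K to the stable vertices of rank
  -- at least r.
  Code : Set
  Code = Fin (2 ^ n) × Fin (d ^ n) × Fin ((2 ^ r) ^ d) × Fin (2 ^ N)

  -- Row-major position in the matrix whose rows are the clique vertices and whose columns are the
  -- stable vertices of rank at least `r`.
  index : (κ : Fin n → Bool) → Fin n → Fin n → ℕ
  index κ x y = (size κ false ∸ r) * rank κ x + (rank κ y ∸ r)

  bitAt : Fin (2 ^ N) → ℕ → Bool
  bitAt c i with i ℕ.<? N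
  ... | yes i<N = bits c (fromℕ< i<N)
  ... | no _    = false

  crossAdj : Code → Fin n → Fin n → Bool
  crossAdj (k , p , g , c) x y with rank (bits k) y ℕ.<? r
  ... | yes l<r = bits (finToFun {2 ^ r} {d} g (finToFun {d} {n} p x)) (fromℕ< l<r)
  ... | no _    = bitAt c (index (bits k) x y)

  sideAdj : Bool → Bool → Code → Fin n → Fin n → Bool
  sideAdj true  true  z x y = not (does (x ≟ y))
  sideAdj true  false z x y = crossAdj z x y
  sideAdj false true  z x y = crossAdj z y x
  sideAdj false false z x y = false

  decode : Code → Fin n → Fin n → Bool
  decode z@(k , _) x y = sideAdj (bits k x) (bits k y) z x y

  module _ {κ : Fin n → Bool} where

    Cross : Fin n → Fin n → Set
    Cross x y = κ x ≡ true × κ y ≡ false × r ≤ rank κ y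

    clique-rank< : ∀ {x} → κ x ≡ true → rank κ x < size κ true
    clique-rank< {x} κx = subst (rank κ x <_) (cong (size κ) κx) (rank<size κ x)

    stable-rank< : ∀ {y} → κ y ≡ false → rank κ y < size κ false
    stable-rank< {y} κy = subst (rank κ y <_) (cong (size κ) κy) (rank<size κ y)

    offset< : ∀ {y} → κ y ≡ false → r ≤ rank κ y → rank κ y ∸ r < size κ false ∸ r
    offset< κy r≤ = ℕ.∸-monoˡ-< (stable-rank< κy) r≤

    index< : ∀ {x y} → Cross x y → index κ x y < N
    index< {x} {y} (κx , κy , r≤) = ℕ.<-≤-trans (flat< (clique-rank< κx) (offset< κy r≤))
      (bound (size κ true) (size κ false ∸ r) (begin
        size κ true + (size κ false ∸ r) + r    ≡⟨ ℕ.+-assoc (size κ true) _ r ⟩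
        size κ true + (size κ false ∸ r + r)    ≡⟨ cong (λ k → size κ true + k) (ℕ.m∸n+n≡m r≤size) ⟩
        size κ true + size κ false              ≡⟨ size-total κ ⟩
        n                                       ∎))
      where
      open ≡-Reasoning
      r≤size : r ≤ size κ false
      r≤size = ℕ.≤-trans r≤ (ℕ.<⇒≤ (stable-rank< κy))

    index-injective : ∀ {x y x′ y′} → Cross x y → Cross x′ y′ →
                      index κ x y ≡ index κ x′ y′ → x ≡ x′ × y ≡ y′
    index-injective (κx , κy , r≤) (κx′ , κy′ , r≤′) eq = let
        i≡ , j≡ = flat-injective (clique-rank< κx) (clique-rank< κx′) (offset< κy r≤) (offset< κy′ r≤′) eq
      in rank-injective κ _ _ (trans κx (sym κx′)) i≡
       , rank-injective κ _ _ (trans κy (sym κy′)) (ℕ.∸-cancelʳ-≡ r≤ r≤′ j≡)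

    store : (M : Fin n → Fin n → Bool) →
            ∃ λ c → ∀ {x y} → Cross x y → bitAt c (index κ x y) ≡ M x y
    store M = fromBits F , stored
      where
      hit? : ∀ i → Dec (∃₂ λ x y → Cross x y × index κ x y ≡ toℕ i × M x y ≡ true)
      hit? i = any? λ x → any? λ y →
        (κ x Bool.≟ true ×-dec κ y Bool.≟ false ×-dec r ℕ.≤? rank κ y)
        ×-dec index κ x y ℕ.≟ toℕ i ×-dec M x y Bool.≟ true
      -- Bit `i` asks whether some pair at position `i` has entry `true`; injectivity of `index`
      -- makes that pair the intended one.
      F : Fin N → Bool
      F i = does (hit? i)
      F-index : ∀ {x y} i → Cross x y → index κ x y ≡ toℕ i → F i ≡ M x y
      F-index {x} {y} i xy eq with hit? i
      ... | no none = sym (¬-not λ Mxy → none (x , y , xy , eq , Mxy))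
      ... | yes (x′ , y′ , xy′ , eq′ , M≡) with refl , refl ← index-injective xy′ xy (trans eq′ (sym eq)) = sym M≡
      stored : ∀ {x y} → Cross x y → bitAt (fromBits F) (index κ x y) ≡ M x y
      stored {x} {y} xy with index κ x y ℕ.<? N
      ... | no i≮N  = contradiction (index< xy) i≮N
      ... | yes i<N = trans (bits-fromBits F _) (F-index _ xy (sym (Fin.toℕ-fromℕ< i<N)))

  module _ {G : Graph n} (sw : Swing G) where

    stable-of-rank? : (l : Fin r) → Dec (∃ λ y → κ sw y ≡ false × rank (κ sw) y ≡ toℕ l)
    stable-of-rank? l = any? λ y → κ sw y Bool.≟ false ×-dec rank (κ sw) y ℕ.≟ toℕ l

    firstStable : Fin r → Fin n
    firstStable l with stable-of-rank? l
    ... | yes (y , _) = y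
    -- A rank that does not occur is filled with `v`; repetitions in the tuple are harmless.
    ... | no _        = v sw

    firstStable-rank : ∀ {y} → κ sw y ≡ false → (l<r : rank (κ sw) y < r) → firstStable (fromℕ< l<r) ≡ y
    firstStable-rank {y} κy l<r with stable-of-rank? (fromℕ< l<r)
    ... | yes (y′ , κy′ , eq) = rank-injective (κ sw) y′ y (trans κy′ (sym κy)) (trans eq (Fin.toℕ-fromℕ< l<r))
    ... | no none = contradiction (y , κy , sym (Fin.toℕ-fromℕ< l<r)) none

    -- Adjacency to a stable vertex of rank below `r` is one bit of the trace, hence determined by
    -- the trace class; the remaining cross adjacencies are stored directly.
    encode : (p : Fin n → Fin d) (g : Fin d → Fin (2 ^ r)) →
      (∀ x → κ sw x ≡ true → trace G firstStable x ≡ g (p x)) →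
      ∃ λ z → ∀ x y → adj G x y ≡ decode z x y
    encode p g covered = z , λ x y → eq x y (κ sw x) (κ sw y) refl refl
      where
      c : Fin (2 ^ N)
      c = proj₁ (store (adj G))
      z : Code
      z = set sw , funToFin p , funToFin g , c
      cross : ∀ x y → κ sw x ≡ true → κ sw y ≡ false → adj G x y ≡ crossAdj z x y
      cross x y κx κy with rank (κ sw) y ℕ.<? r
      ... | no l≮r = sym (proj₂ (store {κ sw} (adj G)) (κx , κy , ℕ.≮⇒≥ l≮r))
      ... | yes l<r = begin
        adj G x y                               ≡⟨ cong (adj G x) (firstStable-rank κy l<r) ⟨
        adj G x (firstStable l)                 ≡⟨ bits-fromBits {r} (λ l → adj G x (firstStable l)) l ⟨
        bits {r} (trace G firstStable x) l          ≡⟨ cong (λ a → bits {r} a l) (covered x κx) ⟩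
        bits {r} (g (p x)) l                        ≡⟨ cong (λ j → bits {r} (g j) l) (finToFun-funToFin p x) ⟨
        bits {r} (g (finToFun {d} {n} (funToFin p) x)) l    ≡⟨ cong (λ a → bits {r} a l) (finToFun-funToFin g _) ⟨
        bits {r} (finToFun {2 ^ r} {d} (funToFin g) (finToFun {d} {n} (funToFin p) x)) l ∎
        where
        open ≡-Reasoning
        l = fromℕ< l<r
      eq : ∀ x y b b′ → κ sw x ≡ b → κ sw y ≡ b′ → adj G x y ≡ sideAdj (κ sw x) (κ sw y) z x y
      eq x y b b′ κx κy = trans (eq′ b b′ κx κy) (sym (cong₂ (λ b b′ → sideAdj b b′ z x y) κx κy))
        where
        eq′ : ∀ b b′ → κ sw x ≡ b → κ sw y ≡ b′ → adj G x y ≡ sideAdj b b′ z x y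
        eq′ true  true  κx κy with x ≟ y
        ... | yes refl = adj-irrefl G x
        ... | no x≢y   = clique (part sw) κx κy x≢y
        eq′ true  false κx κy = cross x y κx κy
        eq′ false true  κx κy = trans (adj-sym G x y) (cross y x κy κx)
        eq′ false false κx κy = stable (part sw) κx κy

    rich-or-coded : Rich r d G ⊎ ∃ λ z → ∀ x y → adj G x y ≡ decode z x y
    rich-or-coded with distinct-or-covered (fromBits {r} λ _ → false) _≟_ (λ x → κ sw x Bool.≟ true)
                         (trace G firstStable) d
    ... | inj₁ (w , κw , distinct) = inj₁ (record
      { swing = sw ; R = firstStable ; w = w ; κw = κw ; distinct = distinct })
    ... | inj₂ (p , g , covered) = inj₂ (encode p g covered)

-- The counting inequality

_×-Fin_ : ∀ {a b} {A B : Set} → A ↔ Fin a → B ↔ Fin b → (A × B) ↔ Fin (a * b)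
A↔ ×-Fin B↔ = ↔-sym *↔× ↔-∘ (A↔ ×-↔ B↔)

_⊎-Fin_ : ∀ {a b} {A B : Set} → A ↔ Fin a → B ↔ Fin b → (A ⊎ B) ↔ Fin (a + b)
A↔ ⊎-Fin B↔ = ↔-sym +↔⊎ ↔-∘ (A↔ ⊎-↔ B↔)

infixr 5 _×-Fin_
infixr 4 _⊎-Fin_

module _ (n r d N : ℕ) (bound : ∀ a b → a + b + r ≡ n → a * b ≤ N) where
  open Poor n r d N bound

  private
    MarkedClass : Set
    MarkedClass = Fin (#split n) × Fin n × (Fin (suc n) × Fin (suc n)) × Fin (n ^ r)

    module U = Inverse (proj₂ (unbalanced-size n))

    member : Fin (#unbalanced n) → Graph n
    member i = proj₁ (U.from i)

    Outcome : Graph n → Set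
    Outcome G = Rich r d G ⊎ ∃ λ z → ∀ x y → adj G x y ≡ decode z x y

    outcome : ∀ i → Outcome (member i)
    outcome i = rich-or-coded (unbalanced⇒swing (proj₂ (U.from i)))

    -- In the rich case `e` selects the neighbourhood and is recovered from the marked class; in the
    -- coded case it is stored verbatim. Thus every member is counted `2 ^ d` times.
    Encodes : ∀ {G} → Outcome G → Fin (2 ^ d) → MarkedClass ⊎ Code × Fin (2 ^ d) → Set
    Encodes (inj₁ g)       e (inj₁ (z , t)) = Mark (Rich.swing g) {z = z} (Rich.select g e) (Rich.R g) t
    Encodes (inj₂ (c , _)) e (inj₂ z)       = z ≡ (c , e)
    Encodes (inj₁ _)       e (inj₂ _)       = ⊥
    Encodes (inj₂ _)       e (inj₁ _)       = ⊥

    encodable : ∀ {G} (o : Outcome G) e → ∃ (Encodes o e)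
    encodable (inj₁ g)       e = let z , t , m = mark (Rich.swing g) (Rich.select g e) (Rich.R g)
                                 in inj₁ (z , t) , m
    encodable (inj₂ (c , _)) e = inj₂ (c , e) , refl

    encodes⇒≅ : ∀ {G H} (o : Outcome G) (o′ : Outcome H) {e e′} z →
                Encodes o e z → Encodes o′ e′ z → G ≅ H
    encodes⇒≅ (inj₁ g) (inj₁ h) (inj₁ (_ , t)) m m′ = proj₁ (_≅ₘ_.iso i) , ≅ₘ⇒≅ _ _ i
      where i = mark-unique (Rich.swing g) (Rich.swing h) {t = t} m m′
    encodes⇒≅ {G} (inj₂ (c , eq)) (inj₂ (.c , eq′)) (inj₂ _) refl refl =
      proj₁ (≅-refl {G = G}) , λ x y → trans (eq x y) (sym (eq′ x y))

    encodes-unique : ∀ {G} (o : Outcome G) {e e′} z → Encodes o e z → Encodes o e′ z → e ≡ e′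
    encodes-unique (inj₁ g) (inj₁ (_ , t)) m m′ =
      Rich.select-injective g (mark-unique (Rich.swing g) (Rich.swing g) {t = t} m m′)
    encodes-unique (inj₂ _) (inj₂ _) refl refl = refl

  unbalanced-bound : #unbalanced n * 2 ^ d ≤
    #split n * (n * ((suc n * suc n) * n ^ r)) + (2 ^ n * (d ^ n * ((2 ^ r) ^ d * 2 ^ N))) * 2 ^ d
  unbalanced-bound = encoding⇒≤ {A = Fin (#unbalanced n) × Fin (2 ^ d)} *↔×
    ((↔-id _ ×-Fin ↔-id _ ×-Fin (↔-id _ ×-Fin ↔-id _) ×-Fin ↔-id _) ⊎-Fin
     ((↔-id _ ×-Fin ↔-id _ ×-Fin ↔-id _ ×-Fin ↔-id _) ×-Fin ↔-id _))
    (λ z (i , e) → Encodes (outcome i) e z)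
    (λ (i , e) → encodable (outcome i) e)
    unique
    where
    unique : ∀ {x y z} → Encodes (outcome (proj₁ x)) (proj₂ x) z →
             Encodes (outcome (proj₁ y)) (proj₂ y) z → x ≡ y
    unique {i , e} {j , e′} {z} m m′ = pair i≡j m′
      where
      i≡j : i ≡ j
      -- A common code makes the two members isomorphic, and each class has only one index.
      i≡j = trans (sym (U.strictlyInverseˡ i))
        (trans (U.to-cong (encodes⇒≅ (outcome i) (outcome j) z m m′)) (U.strictlyInverseˡ j))
      pair : ∀ {j} → i ≡ j → Encodes (outcome j) e′ z → (i , e) ≡ (j , e′)
      pair refl m′ = cong (i ,_) (encodes-unique (outcome i) z m m′)

-- Numerical estimates

module _ where
  open ℕ.≤-Reasoning

  ^-bound-* : ∀ {x y} e f → x ≤ 2 ^ e → y ≤ 2 ^ f → x * y ≤ 2 ^ (e + f)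
  ^-bound-* {x} {y} e f x≤ y≤ = begin
    x * y          ≤⟨ ℕ.*-mono-≤ x≤ y≤ ⟩
    2 ^ e * 2 ^ f  ≡⟨ ℕ.^-distribˡ-+-* 2 e f ⟨
    2 ^ (e + f)    ∎

  ^-bound-^ : ∀ {x} e k → x ≤ 2 ^ e → x ^ k ≤ 2 ^ (e * k)
  ^-bound-^ {x} e k x≤ = begin
    x ^ k          ≤⟨ ℕ.^-monoˡ-≤ k x≤ ⟩
    (2 ^ e) ^ k    ≡⟨ ℕ.^-*-assoc 2 e k ⟩
    2 ^ (e * k)    ∎

  private
    -- With `a = p + e`, the second factor is at most `p + 2e + 1`, and the product then falls short
    -- of `a * suc a` by at least `e * suc e`.
    *-≤-near-squareˡ : ∀ {a p q} → p ≤ a → p + q ≤ suc (a + a) → p * q ≤ a * suc a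
    *-≤-near-squareˡ {a} {p} {q} p≤a p+q≤ with e , refl ← ℕ.m≤n⇒∃[o]m+o≡n p≤a = begin
      p * q                            ≤⟨ ℕ.*-monoʳ-≤ p (ℕ.+-cancelˡ-≤ p _ _ (ℕ.≤-trans p+q≤ (ℕ.≤-reflexive (shape p e)))) ⟩
      p * suc (p + e + e)              ≤⟨ ℕ.m≤m+n _ (e * suc e) ⟩
      p * suc (p + e + e) + e * suc e  ≡⟨ expand p e ⟩
      (p + e) * suc (p + e)            ∎
      where
      shape : ∀ p e → suc (p + e + (p + e)) ≡ p + suc (p + e + e)
      shape = solve-∀
      expand : ∀ p e → p * suc (p + e + e) + e * suc e ≡ (p + e) * suc (p + e)
      expand = solve-∀

  *-≤-near-square : ∀ a p q → p + q ≤ suc (a + a) → p * q ≤ a * suc a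
  *-≤-near-square a p q p+q≤ with p ℕ.≤? a
  ... | yes p≤a = *-≤-near-squareˡ p≤a p+q≤
  ... | no p≰a  = begin
    p * q      ≡⟨ ℕ.*-comm p q ⟩
    q * p      ≤⟨ *-≤-near-squareˡ q≤a (ℕ.≤-trans (ℕ.≤-reflexive (ℕ.+-comm q p)) p+q≤) ⟩
    a * suc a  ∎
    where
    q≤a : q ≤ a
    q≤a = ℕ.+-cancelˡ-≤ (suc a) q a (ℕ.≤-trans (ℕ.+-monoˡ-≤ q (ℕ.≰⇒> p≰a)) p+q≤)

  -- The choice of parameters r = 8 L, d = 1 + L (r + 4) and N = a (a + 1), where
  -- ⌊ n / 2 ⌋ = h = a + 4 L and a = 128 L² + b; the polynomial in l and b is the slack.
  exponent-≡ : ∀ l b → let L = suc l; a = 128 * (L * L) + b; h = a + 4 * L; r = 8 * L; d = suc (L * (r + 4)) in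
    suc L + r * d + a * suc a + suc (L + L) * suc (h + h)
      + (11 + 493 * l + 928 * (l * l) + 448 * (l * l * l) + b + 4 * (b * l)) ≡ h * h
  exponent-≡ = solve-∀

  -- The left side collects the exponents of the poor case: `2 * n`, the clique side, the trace
  -- classes, the traces, the remaining matrix, and the factor `n ^ n`.
  exponent-≤ : ∀ {n h m} l b → let L = suc l; a = 128 * (L * L) + b; r = 8 * L; d = suc (L * (r + 4)) in
    h ≡ a + 4 * L → n ≤ suc (h + h) → h ≤ m →
    suc L + (n + (L * n + (r * d + a * suc a))) + L * n ≤ h * m
  exponent-≤ {n} {h} {m} l b refl n≤ h≤m = begin
    suc L + (n + (L * n + (r₀ * d₀ + a * suc a))) + L * n    ≡⟨ collect L n (r₀ * d₀) (a * suc a) ⟩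
    suc L + r₀ * d₀ + a * suc a + suc (L + L) * n            ≤⟨ ℕ.+-monoʳ-≤ (suc L + r₀ * d₀ + a * suc a) (ℕ.*-monoʳ-≤ (suc (L + L)) n≤) ⟩
    suc L + r₀ * d₀ + a * suc a + suc (L + L) * suc (h + h)  ≤⟨ ℕ.m≤m+n _ _ ⟩
    _                                                          ≡⟨ exponent-≡ l b ⟩
    h * h                                                      ≤⟨ ℕ.*-monoʳ-≤ h h≤m ⟩
    h * m                                                      ∎
    where
    L = suc l
    a = 128 * (L * L) + b
    r₀ = 8 * L
    d₀ = suc (L * (r₀ + 4))
    collect : ∀ L n x y → suc L + (n + (L * n + (x + y))) + L * n ≡ suc L + x + y + suc (L + L) * n
    collect = solve-∀

  -- Multiplied by `2 * n`, each summand of the upper bound is at most `s * D`.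
  combine-bounds : ∀ {u s A B D X P} n → .{{NonZero D}} → .{{NonZero X}} →
    u * D ≤ s * A + B * D → P ≤ s * X → 2 * n * A ≤ D → 2 * n * B * X ≤ P → n * u ≤ s
  combine-bounds {u} {s} {A} {B} {D} {X} {P} n upper lower A≤ B≤ =
    ℕ.*-cancelˡ-≤ 2 (ℕ.*-cancelʳ-≤ (2 * (n * u)) (2 * s) D (begin
      2 * (n * u) * D                    ≡⟨ eq₁ n u D ⟩
      2 * n * (u * D)                    ≤⟨ ℕ.*-monoʳ-≤ (2 * n) upper ⟩
      2 * n * (s * A + B * D)            ≡⟨ eq₂ n s A B D ⟩
      s * (2 * n * A) + 2 * n * B * D    ≤⟨ ℕ.+-mono-≤ (ℕ.*-monoʳ-≤ s A≤) (ℕ.*-monoˡ-≤ D 2nB≤s) ⟩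
      s * D + s * D                      ≡⟨ eq₃ s D ⟩
      2 * s * D                          ∎))
    where
    2nB≤s : 2 * n * B ≤ s
    2nB≤s = ℕ.*-cancelʳ-≤ (2 * n * B) s X (ℕ.≤-trans B≤ lower)
    eq₁ : ∀ n u D → 2 * (n * u) * D ≡ 2 * n * (u * D)
    eq₁ = solve-∀
    eq₂ : ∀ n s A B D → 2 * n * (s * A + B * D) ≡ s * (2 * n * A) + 2 * n * B * D
    eq₂ = solve-∀
    eq₃ : ∀ s D → s * D + s * D ≡ 2 * s * D
    eq₃ = solve-∀

  binary-length : ∀ n → ∃ λ L → suc n < 2 ^ L × 2 ^ L ≤ 2 * suc n
  binary-length zero    = 1 , ℕ.≤-refl , ℕ.≤-refl
  binary-length (suc n) with L , n< , ≤2n ← binary-length n with suc (suc n) ℕ.<? 2 ^ L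
  ... | yes n<′ = L , n<′ , ℕ.≤-trans ≤2n (ℕ.*-monoʳ-≤ 2 (ℕ.n≤1+n (suc n)))
  ... | no n≮   = suc L , ℕ.<-≤-trans (ℕ.m<m+n (suc (suc n)) (s≤s z≤n)) (ℕ.*-monoʳ-≤ 2 n<) , ℕ.*-monoʳ-≤ 2 (ℕ.≮⇒≥ n≮)

  quadratic-doubling : ∀ {L} → 3 ≤ L → 4 * (128 * (suc L * suc L) + 4 * suc L) ≤ 2 * (4 * (128 * (L * L) + 4 * L))
  quadratic-doubling (s≤s (s≤s (s≤s (z≤n {y})))) = ℕ.≤-trans (ℕ.m≤m+n _ (1056 + 2064 * y + 512 * (y * y)))
    (ℕ.≤-reflexive (double y))
    where
    double : ∀ y → 4 * (128 * ((4 + y) * (4 + y)) + 4 * (4 + y)) + (1056 + 2064 * y + 512 * (y * y))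
                   ≡ 2 * (4 * (128 * ((3 + y) * (3 + y)) + 4 * (3 + y)))
    double = solve-∀

  quadratic≤exponential : ∀ {L} → 18 ≤′ L → 4 * (128 * (L * L) + 4 * L) ≤ 2 ^ L
  -- The two sides are 166176 and 262144 here; at 17 the inequality still fails.
  quadratic≤exponential (≤′-reflexive refl) = ℕ.≤ᵇ⇒≤ (4 * (128 * (18 * 18) + 4 * 18)) (2 ^ 18) _
  quadratic≤exponential {suc L} (≤′-step 18≤L) = begin
    4 * (128 * (suc L * suc L) + 4 * suc L)  ≤⟨ quadratic-doubling (ℕ.≤-trans (s≤s (s≤s (s≤s z≤n))) (ℕ.≤′⇒≤ 18≤L)) ⟩
    2 * (4 * (128 * (L * L) + 4 * L))        ≤⟨ ℕ.*-monoʳ-≤ 2 (quadratic≤exponential 18≤L) ⟩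
    2 * 2 ^ L                                ∎

-- Comparison of the two numbers for large `n`

n*#unbalanced≤#split-at : ∀ {n} .{{_ : NonZero n}} l b → let L = suc l in
  ⌊ n /2⌋ ≡ 128 * (L * L) + b + 4 * L → suc n ≤ 2 ^ L → n * #unbalanced n ≤ #split n
n*#unbalanced≤#split-at {n} l b h≡ n≤ = combine-bounds n {{ℕ.m^n≢0 2 d₀}} {{ℕ.m^n≢0 n n}}
  (unbalanced-bound n r₀ d₀ N bound) lower rich-bound poor-bound
  where
  L = suc l
  a = 128 * (L * L) + b
  h = a + 4 * L
  N = a * suc a
  r₀ = 8 * L
  d₀ = suc (L * (r₀ + 4))

  n≤2h+1 : n ≤ suc (h + h)
  n≤2h+1 = begin
    n                        ≡⟨ ℕ.⌊n/2⌋+⌈n/2⌉≡n n ⟨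
    ⌊ n /2⌋ + ⌈ n /2⌉        ≤⟨ ℕ.+-monoʳ-≤ ⌊ n /2⌋ (ℕ.⌊n/2⌋-mono (ℕ.n≤1+n (suc n))) ⟩
    ⌊ n /2⌋ + suc ⌊ n /2⌋    ≡⟨ cong (λ h → h + suc h) h≡ ⟩
    h + suc h                ≡⟨ ℕ.+-suc h h ⟩
    suc (h + h)              ∎
    where open ℕ.≤-Reasoning

  bound : ∀ p q → p + q + r₀ ≡ n → p * q ≤ N
  -- Removing `r₀ = 8 * L` vertices from at most `2h + 1`, where `h = a + 4 * L`, leaves at most
  -- `2a + 1`.
  bound p q refl = *-≤-near-square a p q
    (ℕ.+-cancelʳ-≤ r₀ _ _ (ℕ.≤-trans n≤2h+1 (ℕ.≤-reflexive (shape a L))))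
    where
    shape : ∀ a L → suc (a + 4 * L + (a + 4 * L)) ≡ suc (a + a) + 8 * L
    shape = solve-∀

  lower : 2 ^ (⌊ n /2⌋ * ⌈ n /2⌉) ≤ #split n * n ^ n
  lower = subst (λ k → 2 ^ (⌊ n /2⌋ * ⌈ n /2⌉) ≤ #split k * k ^ k) (ℕ.⌊n/2⌋+⌈n/2⌉≡n n)
    (2^*≤#split*^ ⌊ n /2⌋ ⌈ n /2⌉)

  n≤2^L : n ≤ 2 ^ L
  n≤2^L = ℕ.≤-trans (ℕ.n≤1+n n) n≤

  2n≤2^[1+L] : 2 * n ≤ 2 ^ suc L
  2n≤2^[1+L] = ℕ.*-monoʳ-≤ 2 n≤2^L

  d₀≤2^L : d₀ ≤ 2 ^ L
  d₀≤2^L = begin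
    d₀                                                   ≤⟨ ℕ.m≤m+n d₀ _ ⟩
    d₀ + (119 + 240 * l + 120 * (l * l) + b)             ≡⟨ shape l b ⟩
    h                                                    ≡⟨ h≡ ⟨
    ⌊ n /2⌋                                              ≤⟨ ℕ.⌊n/2⌋≤n n ⟩
    n                                                    ≤⟨ n≤2^L ⟩
    2 ^ L                                                ∎
    where
    open ℕ.≤-Reasoning
    shape : ∀ l b → suc (suc l * (8 * suc l + 4)) + (119 + 240 * l + 120 * (l * l) + b)
                    ≡ 128 * (suc l * suc l) + b + 4 * suc l
    shape = solve-∀

  rich-bound : 2 * n * (n * ((suc n * suc n) * n ^ r₀)) ≤ 2 ^ d₀
  rich-bound = ℕ.≤-trans
    (^-bound-* (suc L) _ 2n≤2^[1+L] (^-bound-* L _ n≤2^L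
      (^-bound-* (L + L) _ (^-bound-* L L n≤ n≤) (^-bound-^ L r₀ n≤2^L))))
    -- The exponents add up to exactly `d₀`, which accounts for its definition.
    (ℕ.≤-reflexive (cong (2 ^_) (shape L r₀)))
    where
    shape : ∀ L r₀ → suc L + (L + (L + L + L * r₀)) ≡ suc (L * (r₀ + 4))
    shape = solve-∀

  poor-bound : 2 * n * (2 ^ n * (d₀ ^ n * ((2 ^ r₀) ^ d₀ * 2 ^ N))) * n ^ n ≤
               2 ^ (⌊ n /2⌋ * ⌈ n /2⌉)
  poor-bound = ℕ.≤-trans
    (^-bound-* (suc L + (n + (L * n + (r₀ * d₀ + N)))) (L * n)
      (^-bound-* (suc L) (n + (L * n + (r₀ * d₀ + N))) 2n≤2^[1+L]
        (^-bound-* n (L * n + (r₀ * d₀ + N)) ℕ.≤-refl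
          (^-bound-* (L * n) (r₀ * d₀ + N) (^-bound-^ L n d₀≤2^L)
            (^-bound-* (r₀ * d₀) N (^-bound-^ r₀ d₀ ℕ.≤-refl) ℕ.≤-refl))))
      (^-bound-^ L n n≤2^L))
    (ℕ.^-monoʳ-≤ 2 (exponent-≤ l b h≡
      (subst (λ h → n ≤ suc (h + h)) (sym h≡) n≤2h+1) (ℕ.⌊n/2⌋≤⌈n/2⌉ n)))

n*#unbalanced≤#split : ∀ {n} → 2 ^ 18 ≤ n → n * #unbalanced n ≤ #split n
n*#unbalanced≤#split {suc n} 2^18≤n = go (binary-length n)
  where
  go : (∃ λ L → suc n < 2 ^ L × 2 ^ L ≤ 2 * suc n) → suc n * #unbalanced (suc n) ≤ #split (suc n)
  go (zero , s≤s () , _)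
  go (L@(suc l) , n< , ≤2n) = n*#unbalanced≤#split-at l b (sym (trans (shape (128 * (L * L)) b (4 * L)) (proj₂ rest))) n<
    where
    18≤L : 18 ≤ L
    18≤L = ℕ.≮⇒≥ λ L<18 → ℕ.<⇒≱ (ℕ.≤-<-trans 2^18≤n n<) (ℕ.^-monoʳ-≤ 2 (ℕ.<⇒≤ L<18))

    h≥ : 128 * (L * L) + 4 * L ≤ ⌊ suc n /2⌋
    -- The strict bound by `suc h` absorbs the rounding in half the number of vertices; the excess
    -- over the required size becomes `b`.
    h≥ = ℕ.≤-pred (ℕ.*-cancelˡ-< 4 _ _ (begin-strict
      4 * (128 * (L * L) + 4 * L)                  ≤⟨ quadratic≤exponential {L} (ℕ.≤⇒≤′ 18≤L) ⟩
      2 ^ L                                        ≤⟨ ≤2n ⟩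
      2 * suc n                                    ≡⟨ cong (2 *_) (ℕ.⌊n/2⌋+⌈n/2⌉≡n (suc n)) ⟨
      2 * (h + ⌈ suc n /2⌉)                        ≤⟨ ℕ.*-monoʳ-≤ 2 (ℕ.+-monoʳ-≤ h (ℕ.⌊n/2⌋-mono (ℕ.n≤1+n (suc (suc n))))) ⟩
      2 * (h + suc h)                              <⟨ ℕ.m<m+n _ (s≤s z≤n) ⟩
      2 * (h + suc h) + 2                          ≡⟨ four h ⟩
      4 * suc h                                    ∎))
      where
      open ℕ.≤-Reasoning
      h = ⌊ suc n /2⌋
      four : ∀ h → 2 * (h + suc h) + 2 ≡ 4 * suc h
      four = solve-∀

    rest = ℕ.m≤n⇒∃[o]m+o≡n h≥
    b = proj₁ rest

    shape : ∀ x b y → x + b + y ≡ x + y + b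
    shape = solve-∀

-- The limit

-- A positive `ε` has numerator at least one, so it is at least the reciprocal of its denominator.
/-small : ∀ u s .{{_ : NonZero s}} ε → 0ℚ ℚ.< ε → u * ↧ₙ ε < s → ℚ.∣ + u / s ℚ.- 0ℚ ∣ ℚ.< ε
/-small u (suc s) ε@(mkℚ +[1+ p ] q _) 0<ε u*q<s = begin-strict
  ℚ.∣ + u / suc s ℚ.- 0ℚ ∣  ≡⟨ cong ℚ.∣_∣ (ℚ.+-identityʳ (+ u / suc s)) ⟩
  ℚ.∣ + u / suc s ∣         ≡⟨ ℚ.0≤p⇒∣p∣≡p (ℚ.nonNegative⁻¹ (+ u / suc s) {{ℚ.normalize-nonNeg u (suc s)}}) ⟩
  + u / suc s               <⟨ ℚ.toℚᵘ-cancel-< (ℚᵘ.<-respˡ-≃ (ℚᵘ.≃-sym (ℚ.toℚᵘ-fromℚᵘ (mkℚᵘ (+ u) s)))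
                                (ℚᵘ.*<* (subst₂ ℤ._<_ (ℤ.pos-* u (suc q)) (ℤ.pos-* (suc p) (suc s))
                                  (ℤ.+<+ (ℕ.<-≤-trans u*q<s (ℕ.m≤m+n (suc s) _)))))) ⟩
  ε                         ∎
  where open ℚ.≤-Reasoning
/-small u s ε@(mkℚ (+ 0) _ _) 0<ε _ with () ← ℚ.positive 0<ε
/-small u s ε@(mkℚ -[1+ _ ] _ _) 0<ε _ with () ← ℚ.positive 0<ε

theorem3p14 : (λ n → (+ #unbalanced n) / #split n) ⟶ 0ℚ
-- The threshold puts `n` above the denominator `q` and into the range where
-- `n * #unbalanced n ≤ #split n`.
theorem3p14 ε 0<ε = suc q + 2 ^ 18 , λ n n≥ →
  /-small (#unbalanced n) (#split n) ε 0<ε (small n n≥ (#unbalanced n) refl)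
  where
  q = ↧ₙ ε
  small : ∀ n → suc q + 2 ^ 18 ≤ n → ∀ u → u ≡ #unbalanced n → u * q < #split n
  -- For `u = 0` multiplying `q < n` by `u` is not strict; the positivity of `#split n` is used
  -- instead.
  small n n≥ zero    _  = >-nonZero⁻¹ (#split n)
  small n n≥ (suc u) eq = begin-strict
    suc u * q               <⟨ ℕ.*-monoʳ-< (suc u) (ℕ.≤-trans (ℕ.m≤m+n (suc q) (2 ^ 18)) n≥) ⟩
    suc u * n               ≡⟨ ℕ.*-comm (suc u) n ⟩
    n * suc u               ≡⟨ cong (n *_) eq ⟩
    n * #unbalanced n       ≤⟨ n*#unbalanced≤#split (ℕ.≤-trans (ℕ.m≤n+m (2 ^ 18) (suc q)) n≥) ⟩
    #split n                ∎
    where open ℕ.≤-Reasoning
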